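{- Let $\varphi=\bigwedge_{i=1}^n (C_i\to L_i)$ (with $n\ge 1$) be a Horn formula and let $L\in P\cup\{\bot\}$ be a positive literal. If $L\notin\{L_1,\dots,L_n\}$, then $L\notin\mathcal A(\varphi,\{\top\})$.
   Context: Let $P$ be a countable set of propositional symbols. A positive literal is an element of $P\cup\{\bot\}$ (so $\bot$ counts as a positive literal; $\top$ does not, since $\top$ abbreviates $\neg\bot$). A Horn formula is a propositional formula $\varphi=\bigwedge_{i=1}^n (C_i\to L_i)$ with $n\ge 1$, where each $L_i$ is a positive literal and each $C_i$ is either $\top$ or a conjunction $\bigwedge_{j=1}^{k_i}L_{i,j}$ with $k_i\ge 1$ of positive literals. The implications $C_i\to L_i$ are the clauses of $\varphi$. Put $\mathrm{set}(\top)=\{\top\}$ and $\mathrm{set}(\bigwedge_{j=1}^{k}L_j)=\{L_1,\dots,L_k\}$. Write $\varphi\setminus(C_i\to L_i)$ for the formula obtained from $\varphi$ by removing the $i$-th clause; removing the only clause gives the empty conjunction, written $\top$. The function $\mathcal A$ takes a (possibly empty) conjunction $\varphi=\bigwedge_{i=1}^n (C_i\to L_i)$ with $n\ge 0$, where each $L_i$ is a positive literal and each $C_i$ is either $\top$ or a conjunction of one or more positive literals, together with a set $\mathcal C\subseteq P\cup\{\bot,\top\}$, and returns a subset of $P\cup\{\bot,\top\}$, as follows: if $\varphi$ is the empty conjunction, return $\mathcal C$; otherwise, if some clause $C_i\to L_i$ of $\varphi$ satisfies $\mathrm{set}(C_i)\subseteq\mathcal C$, choose any such $i$ and return $\mathcal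 A(\varphi\setminus(C_i\to L_i),\,\mathcal C\cup\{L_i\})$; otherwise return $\mathcal C$. The choice of $i$ is non-deterministic; statements about $\mathcal A(\varphi,\mathcal C)$ are understood to hold for the set returned under every sequence of choices. -}

module Defs where

open import Data.Fin.Base using (Fin)
open import Data.List.Base using (List; []; _∷_; length; lookup; map; removeAt)
import Data.List.Membership.Propositional as List
open import Data.List.NonEmpty.Base using (List⁺; toList)
open import Data.Nat.Base using (ℕ)
open import Data.Product.Base using (∃)
open import Function.Bundles using (_↣_)
open import Level using (0ℓ)
open import Relation.Nullary.Negation.Core using (¬_)
open import Relation.Unary using (Pred; _⊆_; _∪_; ｛_｝)

-- Finite (possibly empty) or countably infinite.
Countable : Set → Set
Countable A = A ↣ ℕ

data PositiveLiteral (P : Set) : Set where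
  atom : P → PositiveLiteral P
  bot  : PositiveLiteral P

-- P ∪ {⊥, ⊤}
data Symbol (P : Set) : Set where
  lit : PositiveLiteral P → Symbol P
  top : Symbol P

data Antecedent (P : Set) : Set where
  ⊤ₐ : Antecedent P
  ⋀  : List⁺ (PositiveLiteral P) → Antecedent P

infix 5 _⇒_

record Clause (P : Set) : Set where
  constructor _⇒_
  field
    antecedent : Antecedent P
    consequent : PositiveLiteral P

open Clause public

-- A conjunction is given by its sequence of clauses, so that repeated clauses
-- count separately and [] is the empty conjunction.
Conjunction : Set → Set
Conjunction P = List (Clause P)

HornFormula : Set → Set
HornFormula P = List⁺ (Clause P)

consequents : ∀ {P} → HornFormula P → List (PositiveLiteral P)
consequents φ = map consequent (toList φ)

SymbolSet : Set → Set₁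
SymbolSet P = Pred (Symbol P) 0ℓ

set : ∀ {P} → Antecedent P → SymbolSet P
set ⊤ₐ     = ｛ top ｝
set (⋀ Ls) = λ x → x List.∈ map lit (toList Ls)

Applicable : ∀ {P} (φ : Conjunction P) → SymbolSet P → Pred (Fin (length φ)) 0ℓ
Applicable φ 𝒞 i = set (antecedent (lookup φ i)) ⊆ 𝒞

-- The algorithm is non-deterministic, so it is given by its input-output
-- relation: 𝒜 φ 𝒞 ℛ says that some sequence of choices on input (φ, 𝒞)
-- returns ℛ.  Derivations of 𝒜 φ 𝒞 ℛ are exactly the complete runs.
data 𝒜 {P : Set} : Conjunction P → SymbolSet P → SymbolSet P → Set₁ where
  empty : ∀ {𝒞} → 𝒜 [] 𝒞 𝒞
  step  : ∀ {φ 𝒞 ℛ} (i : Fin (length φ)) → Applicable φ 𝒞 i →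
          𝒜 (removeAt φ i) (𝒞 ∪ ｛ lit (consequent (lookup φ i)) ｝) ℛ →
          𝒜 φ 𝒞 ℛ
  stuck : ∀ {c φ 𝒞} → ¬ ∃ (Applicable (c ∷ φ) 𝒞) → 𝒜 (c ∷ φ) 𝒞 𝒞

{-# OPTIONS --safe #-}
module Submission where

open import Defs
open import Data.Fin.Base using (Fin; zero; suc)
open import Data.List.Base using (List; _∷_; length; map; removeAt)
open import Data.List.Membership.Propositional using (_∈_) renaming (_∉_ to _∉ₗ_)
open import Data.List.Membership.Propositional.Properties using (∈-lookup; ∈-map⁺)
open import Data.List.NonEmpty.Base using (toList)
open import Data.List.Relation.Binary.Subset.Propositional using (_⊆_)
open import Data.List.Relation.Binary.Subset.Propositional.Properties using (map⁺)
open import Data.List.Relation.Unary.Any using (here; there)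
open import Data.Sum.Base using (_⊎_; inj₁; inj₂)
open import Relation.Binary.PropositionalEquality.Core using (refl)
open import Relation.Unary using (_∉_; ｛_｝)

-- A run only ever enlarges its set by the consequent of a clause of the current conjunction, and
-- removing clauses creates no new consequents. So each literal returned was present initially or is
-- a consequent of `φ`; the initial set of `top` alone contains no literal.

removeAt-⊆ : ∀ {a} {A : Set a} (xs : List A) (i : Fin (length xs)) → removeAt xs i ⊆ xs
removeAt-⊆ (x ∷ xs)         zero    y∈         = there y∈
-- `i` indexes the tail, which therefore cannot be empty.
removeAt-⊆ (x ∷ xs@(_ ∷ _)) (suc i) (here eq)  = here eq
removeAt-⊆ (x ∷ xs@(_ ∷ _)) (suc i) (there y∈) = there (removeAt-⊆ xs i y∈)

-- Induction on the run. Both `φ` and `𝒞` are arbitrary, since each step changes both.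
𝒜-sound : ∀ {P} {φ : Conjunction P} {𝒞 ℛ : SymbolSet P} → 𝒜 φ 𝒞 ℛ →
          ∀ {L} → ℛ (lit L) → 𝒞 (lit L) ⊎ L ∈ map consequent φ
𝒜-sound empty     L∈ℛ = inj₁ L∈ℛ
𝒜-sound (stuck _) L∈ℛ = inj₁ L∈ℛ
𝒜-sound (step {φ} i _ run) L∈ℛ with 𝒜-sound run L∈ℛ
... | inj₁ (inj₁ L∈𝒞)  = inj₁ L∈𝒞
-- `L` is the literal added by this very step.
... | inj₁ (inj₂ refl) = inj₂ (∈-map⁺ consequent (∈-lookup i))
... | inj₂ L∈rest      = inj₂ (map⁺ consequent (removeAt-⊆ φ i) L∈rest)

corollary3p2 : (P : Set) → Countable P →
    (φ : HornFormula P) (L : PositiveLiteral P) →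
    L ∉ₗ consequents φ →
    (ℛ : SymbolSet P) → 𝒜 (toList φ) ｛ top ｝ ℛ →
    lit L ∉ ℛ
corollary3p2 P _ φ L L∉ ℛ run L∈ℛ with 𝒜-sound run L∈ℛ
-- The case `inj₁` would give `top ≡ lit L`, a clash of constructors.
... | inj₂ L∈ = L∉ L∈
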